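{- Let $k \geq 2$ be an integer. For any sequence $\{F_n(k)\}_{n \geq 0}$ of complex numbers satisfying $F_n(k) = F_{n-1}(k) + F_{n-2}(k) + \dots + F_{n-k}(k)$ for all $n \geq k$, we have, for all $n \geq 0$, $$F_n(k) = \sum_{j=0}^{k-1} F_j(k)\, B_n(k,j).$$
   Context: For integers $k \geq 2$ and $0 \leq j \leq k-1$, the sequence $\{B_n(k,j)\}_{n\geq 0}$ is defined by the recurrence $B_n(k,j) = B_{n-1}(k,j) + B_{n-2}(k,j)+\dots+B_{n-k}(k,j)$ for all $n \geq k$, with initial values $B_j(k,j)=1$ and $B_i(k,j)=0$ for $0 \leq i \leq k-1$, $i \neq j$. -}

module Defs where

open import Algebra.Bundles using (RawMonoid; CommutativeRing)
open import Algebra.Structures using (IsCommutativeRing)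
import Algebra.Definitions.RawMonoid as RawMonoidDefs
import Algebra.Properties.Monoid.Sum as MonoidSum
open import Data.Bool.Base using (if_then_else_)
open import Data.Fin.Base using (Fin; toℕ)
open import Data.Fin.Properties using (toℕ<n)
open import Data.Integer.Base using (+_)
open import Data.Nat.Base as ℕ using (ℕ; suc)
open import Data.Nat.Induction using (<-wellFounded)
import Data.Nat.Properties as ℕ
open import Data.Product.Base using (∃; _×_; _,_; proj₁; proj₂)
open import Data.Rational.Base as ℚ using (ℚ; 0ℚ; 1ℚ; ½; ∣_∣; _/_)
import Data.Rational.Properties as ℚ
open import Data.Rational.Solver using (module +-*-Solver)
open import Function.Base using (const)
open import Induction.WellFounded using (module All; module FixPoint)
open import Level using (0ℓ)
open import Relation.Binary.PropositionalEquality
  using (_≡_; _≢_; refl; sym; trans; cong; subst)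
open import Relation.Nullary using (yes; no; does; contradiction)
open import Relation.Nullary.Decidable using (dec-true; dec-false)

-- F n ≈ F (n - 1) + … + F (n - k) for n ≥ k; the bound k ≤ n makes every
-- truncated subtraction exact.
SumOfPrevious : ∀ {c ℓ} (M : RawMonoid c ℓ) → ℕ → (ℕ → RawMonoid.Carrier M) → Set ℓ
SumOfPrevious M k F =
  ∀ n → k ℕ.≤ n → F n ≈ sum {k} (λ i → F (n ℕ.∸ suc (toℕ i)))
  where
  open RawMonoid M using (_≈_)
  open RawMonoidDefs M using (sum)

private
  open module ℕSum = MonoidSum ℕ.+-0-monoid using (sum)

  previous : ∀ {k n} → k ℕ.≤ n → (i : Fin k) → n ℕ.∸ suc (toℕ i) ℕ.< n
  previous k≤n i = ℕ.∸-monoʳ-< ℕ.z<s (ℕ.≤-trans (toℕ<n i) k≤n)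

  B-step : ∀ k → Fin k → ∀ n → (∀ {m} → m ℕ.< n → ℕ) → ℕ
  B-step k j n B[_] with n ℕ.<? k
  ... | yes _   = if does (n ℕ.≟ toℕ j) then 1 else 0
  ... | no  n≮k = sum {k} (λ i → B[ previous (ℕ.≮⇒≥ n≮k) i ])

-- B k j n is Bₙ(k,j).  It is natural-number valued, and determined by
-- B-initial-1, B-initial-0 and B-recurrence below.
B : (k : ℕ) → Fin k → ℕ → ℕ
B k j = All.wfRec <-wellFounded 0ℓ (const ℕ) (B-step k j)

private
  B-step-ext : ∀ k j n {B₁ B₂ : ∀ {m} → m ℕ.< n → ℕ} →
               (∀ {m} (m<n : m ℕ.< n) → B₁ m<n ≡ B₂ m<n) →
               B-step k j n B₁ ≡ B-step k j n B₂
  B-step-ext k j n eq with n ℕ.<? k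
  ... | yes _   = refl
  ... | no  n≮k = ℕSum.sum-cong-≗ {k} (λ i → eq (previous (ℕ.≮⇒≥ n≮k) i))

  B-unfold : ∀ k j n → B k j n ≡ B-step k j n (λ {m} _ → B k j m)
  B-unfold k j n =
    FixPoint.unfold-wfRec <-wellFounded (const ℕ) (B-step k j) (B-step-ext k j)

  B-initial : ∀ k j n → n ℕ.< k → B k j n ≡ (if does (n ℕ.≟ toℕ j) then 1 else 0)
  B-initial k j n n<k = trans (B-unfold k j n) step
    where
    step : B-step k j n (λ {m} _ → B k j m) ≡ (if does (n ℕ.≟ toℕ j) then 1 else 0)
    step with n ℕ.<? k
    ... | yes _   = refl
    ... | no  n≮k = contradiction n<k n≮k

B-initial-1 : ∀ k j → B k j (toℕ j) ≡ 1
B-initial-1 k j = trans (B-initial k j (toℕ j) (toℕ<n j))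
  (cong (if_then 1 else 0) (dec-true (toℕ j ℕ.≟ toℕ j) refl))

B-initial-0 : ∀ k j i → i ℕ.< k → i ≢ toℕ j → B k j i ≡ 0
B-initial-0 k j i i<k i≢j = trans (B-initial k j i i<k)
  (cong (if_then 1 else 0) (dec-false (i ℕ.≟ toℕ j) i≢j))

B-recurrence : ∀ k j → SumOfPrevious ℕ.+-0-rawMonoid k (B k j)
B-recurrence k j n k≤n = trans (B-unfold k j n) step
  where
  step : B-step k j n (λ {m} _ → B k j m) ≡ sum {k} (λ i → B k j (n ℕ.∸ suc (toℕ i)))
  step with n ℕ.<? k
  ... | yes n<k = contradiction k≤n (ℕ.<⇒≱ n<k)
  ... | no  _   = refl

private
  abstract
    halves : ∀ ε → ε ℚ.* ½ ℚ.+ ε ℚ.* ½ ≡ ε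
    halves ε = trans (sym (ℚ.*-distribˡ-+ ε ½ ½)) (ℚ.*-identityʳ ε)

    half-pos : ∀ {ε} → 0ℚ ℚ.< ε → 0ℚ ℚ.< ε ℚ.* ½
    half-pos = ℚ.*-monoˡ-<-pos ½

    +-bound : ∀ {p q ε} → ∣ p ∣ ℚ.< ε ℚ.* ½ → ∣ q ∣ ℚ.< ε ℚ.* ½ → ∣ p ℚ.+ q ∣ ℚ.< ε
    +-bound {p} {q} {ε} p<ε/2 q<ε/2 = subst (∣ p ℚ.+ q ∣ ℚ.<_) (halves ε)
      (ℚ.≤-<-trans (ℚ.∣p+q∣≤∣p∣+∣q∣ p q) (ℚ.+-mono-< p<ε/2 q<ε/2))

    ∣p-p∣≡0 : ∀ p → ∣ p ℚ.- p ∣ ≡ 0ℚ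
    ∣p-p∣≡0 p = cong ∣_∣ (ℚ.+-inverseʳ p)

    scale : ∀ {M ε} → 0ℚ ℚ.< M → 0ℚ ℚ.< ε → ∃ λ δ → 0ℚ ℚ.< δ × M ℚ.* δ ≡ ε
    scale {M} {ε} 0<M 0<ε = δ , 0<δ , Mδ≡ε
      where
      instance
        M-pos : ℚ.Positive M
        M-pos = ℚ.positive 0<M
        M-nonZero : ℚ.NonZero M
        M-nonZero = ℚ.pos⇒nonZero M
        ε-pos : ℚ.Positive ε
        ε-pos = ℚ.positive 0<ε
        1/M-pos : ℚ.Positive (ℚ.1/ M)
        1/M-pos = ℚ.1/pos⇒pos M
      δ : ℚ
      δ = ℚ.1/ M ℚ.* ε
      0<δ : 0ℚ ℚ.< δ
      0<δ = ℚ.positive⁻¹ δ {{ℚ.pos*pos⇒pos (ℚ.1/ M) ε}}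
      Mδ≡ε : M ℚ.* δ ≡ ε
      Mδ≡ε = trans (sym (ℚ.*-assoc M (ℚ.1/ M) ε))
               (trans (cong (ℚ._* ε) (ℚ.*-inverseʳ M)) (ℚ.*-identityˡ ε))

    *-bound : ∀ {M δ p q} → 0ℚ ℚ.< M → ∣ p ∣ ℚ.≤ M → ∣ q ∣ ℚ.< δ → ∣ p ℚ.* q ∣ ℚ.< M ℚ.* δ
    *-bound {M} {δ} {p} {q} 0<M p≤M q<δ = begin-strict
      ∣ p ℚ.* q ∣         ≡⟨ ℚ.∣p*q∣≡∣p∣*∣q∣ p q ⟩
      ∣ p ∣ ℚ.* ∣ q ∣     ≤⟨ ℚ.*-monoʳ-≤-nonNeg ∣ q ∣ {{ℚ.∣-∣-nonNeg q}} p≤M ⟩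
      M ℚ.* ∣ q ∣         <⟨ ℚ.*-monoʳ-<-pos M {{ℚ.positive 0<M}} q<δ ⟩
      M ℚ.* δ             ∎
      where open ℚ.≤-Reasoning

    *-close : ∀ {M δ ε a b c d} → 0ℚ ℚ.< M → M ℚ.* δ ≡ ε ℚ.* ½ →
              ∣ a ∣ ℚ.≤ M → ∣ d ∣ ℚ.≤ M → ∣ a ℚ.- c ∣ ℚ.< δ → ∣ b ℚ.- d ∣ ℚ.< δ →
              ∣ a ℚ.* b ℚ.- c ℚ.* d ∣ ℚ.< ε
    *-close {M} {δ} {ε} {a} {b} {c} {d} 0<M Mδ≡ε/2 a≤M d≤M a-c<δ b-d<δ =
      subst (λ t → ∣ t ∣ ℚ.< ε) (sym split)
        (+-bound (half a≤M b-d<δ) (half d≤M a-c<δ))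
      where
      half : ∀ {p q} → ∣ p ∣ ℚ.≤ M → ∣ q ∣ ℚ.< δ → ∣ p ℚ.* q ∣ ℚ.< ε ℚ.* ½
      half {p} {q} p≤M q<δ =
        subst (∣ p ℚ.* q ∣ ℚ.<_) Mδ≡ε/2 (*-bound 0<M p≤M q<δ)
      split : a ℚ.* b ℚ.- c ℚ.* d ≡ a ℚ.* (b ℚ.- d) ℚ.+ d ℚ.* (a ℚ.- c)
      split = solve 4 (λ a b c d → a :* b :- c :* d := a :* (b :- d) :+ d :* (a :- c))
                refl a b c d
        where open +-*-Solver

-- ℝ is the Cauchy completion of ℚ: Cauchy sequences of rationals, with
-- equality _≈ʳ_ meaning that the difference tends to 0.

IsCauchy : (ℕ → ℚ) → Set
IsCauchy x = ∀ ε → 0ℚ ℚ.< ε →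
  ∃ λ N → ∀ m n → N ℕ.≤ m → N ℕ.≤ n → ∣ x m ℚ.- x n ∣ ℚ.< ε

record ℝ : Set where
  no-eta-equality
  field
    seq    : ℕ → ℚ
    cauchy : IsCauchy seq

open ℝ public

infix  4 _≈ʳ_
infixl 6 _+ʳ_ _-ʳ_
infixl 7 _*ʳ_
infix  8 -ʳ_

-- A record, so that the two reals can be inferred from a proof.
record _≈ʳ_ (x y : ℝ) : Set where
  no-eta-equality
  field
    null : ∀ ε → 0ℚ ℚ.< ε → ∃ λ N → ∀ n → N ℕ.≤ n → ∣ seq x n ℚ.- seq y n ∣ ℚ.< ε

open _≈ʳ_ public

private
  abstract
    eventuallyBounded : ∀ x → ∃ λ M → 0ℚ ℚ.< M × ∃ λ N → ∀ n → N ℕ.≤ n → ∣ seq x n ∣ ℚ.≤ M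
    eventuallyBounded x =
      M , 0<M , N , bounded
      where
      N : ℕ
      N = proj₁ (cauchy x 1ℚ (ℚ.positive⁻¹ 1ℚ))
      close : ∀ m n → N ℕ.≤ m → N ℕ.≤ n → ∣ seq x m ℚ.- seq x n ∣ ℚ.< 1ℚ
      close = proj₂ (cauchy x 1ℚ (ℚ.positive⁻¹ 1ℚ))
      M : ℚ
      M = 1ℚ ℚ.+ ∣ seq x N ∣
      0<M : 0ℚ ℚ.< M
      0<M = ℚ.+-mono-<-≤ (ℚ.positive⁻¹ 1ℚ) (ℚ.0≤∣p∣ (seq x N))
      bounded : ∀ n → N ℕ.≤ n → ∣ seq x n ∣ ℚ.≤ M
      bounded n N≤n = begin
        ∣ seq x n ∣                                  ≡⟨ cong ∣_∣ (split (seq x n) (seq x N)) ⟩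
        ∣ (seq x n ℚ.- seq x N) ℚ.+ seq x N ∣        ≤⟨ ℚ.∣p+q∣≤∣p∣+∣q∣ (seq x n ℚ.- seq x N) (seq x N) ⟩
        ∣ seq x n ℚ.- seq x N ∣ ℚ.+ ∣ seq x N ∣      ≤⟨ ℚ.+-monoˡ-≤ ∣ seq x N ∣ (ℚ.<⇒≤ (close n N N≤n ℕ.≤-refl)) ⟩
        M                                            ∎
        where
        open ℚ.≤-Reasoning
        open +-*-Solver
        split : ∀ p q → p ≡ (p ℚ.- q) ℚ.+ q
        split = solve 2 (λ p q → p := (p :- q) :+ q) refl

    commonBound : ∀ x y → ∃ λ M → 0ℚ ℚ.< M ×
      ∃ λ N → ∀ n → N ℕ.≤ n → ∣ seq x n ∣ ℚ.≤ M × ∣ seq y n ∣ ℚ.≤ M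
    commonBound x y =
      let M₁ , 0<M₁ , N₁ , x≤M₁ = eventuallyBounded x
          M₂ , 0<M₂ , N₂ , y≤M₂ = eventuallyBounded y
      in M₁ ℚ.⊔ M₂ , ℚ.<-≤-trans 0<M₁ (ℚ.p≤p⊔q M₁ M₂) , N₁ ℕ.⊔ N₂ , λ n N≤n →
        ℚ.≤-trans (x≤M₁ n (ℕ.m⊔n≤o⇒m≤o N₁ N₂ N≤n)) (ℚ.p≤p⊔q M₁ M₂) ,
        ℚ.≤-trans (y≤M₂ n (ℕ.m⊔n≤o⇒n≤o N₁ N₂ N≤n)) (ℚ.p≤q⊔p M₁ M₂)

    +-split : ∀ a b c d → (a ℚ.+ b) ℚ.- (c ℚ.+ d) ≡ (a ℚ.- c) ℚ.+ (b ℚ.- d)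
    +-split = solve 4 (λ a b c d → (a :+ b) :- (c :+ d) := (a :- c) :+ (b :- d)) refl
      where open +-*-Solver

    ∣-p--q∣ : ∀ p q → ∣ (ℚ.- p) ℚ.- (ℚ.- q) ∣ ≡ ∣ p ℚ.- q ∣
    ∣-p--q∣ p q =
      trans (cong ∣_∣ (sym (ℚ.neg-distrib-+ p (ℚ.- q)))) (ℚ.∣-p∣≡∣p∣ (p ℚ.- q))

    ∣p-q∣≡∣q-p∣ : ∀ p q → ∣ p ℚ.- q ∣ ≡ ∣ q ℚ.- p ∣
    ∣p-q∣≡∣q-p∣ p q = trans (sym (ℚ.∣-p∣≡∣p∣ (p ℚ.- q))) (cong ∣_∣ (flip p q))
      where
      open +-*-Solver
      flip : ∀ p q → ℚ.- (p ℚ.- q) ≡ q ℚ.- p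
      flip = solve 2 (λ p q → :- (p :- q) := q :- p) refl

fromℚ : ℚ → ℝ
fromℚ q .seq _ = q
fromℚ q .cauchy ε 0<ε = 0 , λ _ _ _ _ → subst (ℚ._< ε) (sym (∣p-p∣≡0 q)) 0<ε

0ʳ 1ʳ : ℝ
0ʳ = fromℚ 0ℚ
1ʳ = fromℚ 1ℚ

_+ʳ_ : ℝ → ℝ → ℝ
(x +ʳ y) .seq n = seq x n ℚ.+ seq y n
(x +ʳ y) .cauchy ε 0<ε =
  let N₁ , x-close = cauchy x (ε ℚ.* ½) (half-pos 0<ε)
      N₂ , y-close = cauchy y (ε ℚ.* ½) (half-pos 0<ε)
  in N₁ ℕ.⊔ N₂ , λ m n N≤m N≤n →
    subst (λ t → ∣ t ∣ ℚ.< ε) (sym (+-split (seq x m) (seq y m) (seq x n) (seq y n)))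
      (+-bound (x-close m n (ℕ.m⊔n≤o⇒m≤o N₁ N₂ N≤m) (ℕ.m⊔n≤o⇒m≤o N₁ N₂ N≤n))
               (y-close m n (ℕ.m⊔n≤o⇒n≤o N₁ N₂ N≤m) (ℕ.m⊔n≤o⇒n≤o N₁ N₂ N≤n)))

-ʳ_ : ℝ → ℝ
(-ʳ x) .seq n = ℚ.- seq x n
(-ʳ x) .cauchy ε 0<ε =
  let N , close = cauchy x ε 0<ε
  in N , λ m n N≤m N≤n →
    subst (ℚ._< ε) (sym (∣-p--q∣ (seq x m) (seq x n))) (close m n N≤m N≤n)

_-ʳ_ : ℝ → ℝ → ℝ
x -ʳ y = x +ʳ (-ʳ y)

_*ʳ_ : ℝ → ℝ → ℝ
(x *ʳ y) .seq n = seq x n ℚ.* seq y n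
(x *ʳ y) .cauchy ε 0<ε =
  let M , 0<M , N₀ , bounded = commonBound x y
      δ , 0<δ , Mδ≡ε/2 = scale 0<M (half-pos 0<ε)
      N₁ , x-close = cauchy x δ 0<δ
      N₂ , y-close = cauchy y δ 0<δ
  in N₀ ℕ.⊔ (N₁ ℕ.⊔ N₂) , λ m n N≤m N≤n →
    let N₁₂≤m = ℕ.m⊔n≤o⇒n≤o N₀ (N₁ ℕ.⊔ N₂) N≤m
        N₁₂≤n = ℕ.m⊔n≤o⇒n≤o N₀ (N₁ ℕ.⊔ N₂) N≤n
    in *-close {b = seq y m} {c = seq x n} 0<M Mδ≡ε/2
         (proj₁ (bounded m (ℕ.m⊔n≤o⇒m≤o N₀ (N₁ ℕ.⊔ N₂) N≤m)))
         (proj₂ (bounded n (ℕ.m⊔n≤o⇒m≤o N₀ (N₁ ℕ.⊔ N₂) N≤n)))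
         (x-close m n (ℕ.m⊔n≤o⇒m≤o N₁ N₂ N₁₂≤m) (ℕ.m⊔n≤o⇒m≤o N₁ N₂ N₁₂≤n))
         (y-close m n (ℕ.m⊔n≤o⇒n≤o N₁ N₂ N₁₂≤m) (ℕ.m⊔n≤o⇒n≤o N₁ N₂ N₁₂≤n))

pointwise⇒≈ʳ : ∀ {x y} → (∀ n → seq x n ≡ seq y n) → x ≈ʳ y
pointwise⇒≈ʳ {x} {y} eq .null ε 0<ε = 0 , λ n _ →
  subst (ℚ._< ε)
    (sym (trans (cong (λ t → ∣ t ℚ.- seq y n ∣) (eq n)) (∣p-p∣≡0 (seq y n)))) 0<ε

≈ʳ-refl : ∀ {x} → x ≈ʳ x
≈ʳ-refl = pointwise⇒≈ʳ λ _ → refl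

≈ʳ-sym : ∀ {x y} → x ≈ʳ y → y ≈ʳ x
≈ʳ-sym {x} {y} x≈y .null ε 0<ε =
  let N , close = null x≈y ε 0<ε
  in N , λ n N≤n →
    subst (ℚ._< ε) (∣p-q∣≡∣q-p∣ (seq x n) (seq y n)) (close n N≤n)

≈ʳ-trans : ∀ {x y z} → x ≈ʳ y → y ≈ʳ z → x ≈ʳ z
≈ʳ-trans {x} {y} {z} x≈y y≈z .null ε 0<ε =
  let N₁ , xy-close = null x≈y (ε ℚ.* ½) (half-pos 0<ε)
      N₂ , yz-close = null y≈z (ε ℚ.* ½) (half-pos 0<ε)
  in N₁ ℕ.⊔ N₂ , λ n N≤n →
    subst (λ t → ∣ t ∣ ℚ.< ε) (telescope (seq x n) (seq y n) (seq z n))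
      (+-bound (xy-close n (ℕ.m⊔n≤o⇒m≤o N₁ N₂ N≤n)) (yz-close n (ℕ.m⊔n≤o⇒n≤o N₁ N₂ N≤n)))
  where
  open +-*-Solver
  telescope : ∀ p q r → (p ℚ.- q) ℚ.+ (q ℚ.- r) ≡ p ℚ.- r
  telescope = solve 3 (λ p q r → (p :- q) :+ (q :- r) := p :- r) refl

+ʳ-cong : ∀ {x x′ y y′} → x ≈ʳ x′ → y ≈ʳ y′ → x +ʳ y ≈ʳ x′ +ʳ y′
+ʳ-cong {x} {x′} {y} {y′} x≈x′ y≈y′ .null ε 0<ε =
  let N₁ , x-close = null x≈x′ (ε ℚ.* ½) (half-pos 0<ε)
      N₂ , y-close = null y≈y′ (ε ℚ.* ½) (half-pos 0<ε)
  in N₁ ℕ.⊔ N₂ , λ n N≤n →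
    subst (λ t → ∣ t ∣ ℚ.< ε) (sym (+-split (seq x n) (seq y n) (seq x′ n) (seq y′ n)))
      (+-bound (x-close n (ℕ.m⊔n≤o⇒m≤o N₁ N₂ N≤n)) (y-close n (ℕ.m⊔n≤o⇒n≤o N₁ N₂ N≤n)))

-ʳ-cong : ∀ {x y} → x ≈ʳ y → -ʳ x ≈ʳ -ʳ y
-ʳ-cong {x} {y} x≈y .null ε 0<ε =
  let N , close = null x≈y ε 0<ε
  in N , λ n N≤n →
    subst (ℚ._< ε) (sym (∣-p--q∣ (seq x n) (seq y n))) (close n N≤n)

*ʳ-cong : ∀ {x x′ y y′} → x ≈ʳ x′ → y ≈ʳ y′ → x *ʳ y ≈ʳ x′ *ʳ y′
*ʳ-cong {x} {x′} {y} {y′} x≈x′ y≈y′ .null ε 0<ε =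
  let M , 0<M , N₀ , bounded = commonBound x y′
      δ , 0<δ , Mδ≡ε/2 = scale 0<M (half-pos 0<ε)
      N₁ , x-close = null x≈x′ δ 0<δ
      N₂ , y-close = null y≈y′ δ 0<δ
  in N₀ ℕ.⊔ (N₁ ℕ.⊔ N₂) , λ n N≤n →
    let N₁₂≤n = ℕ.m⊔n≤o⇒n≤o N₀ (N₁ ℕ.⊔ N₂) N≤n
        x≤M , y′≤M = bounded n (ℕ.m⊔n≤o⇒m≤o N₀ (N₁ ℕ.⊔ N₂) N≤n)
    in *-close {b = seq y n} {c = seq x′ n} 0<M Mδ≡ε/2 x≤M y′≤M
         (x-close n (ℕ.m⊔n≤o⇒m≤o N₁ N₂ N₁₂≤n))
         (y-close n (ℕ.m⊔n≤o⇒n≤o N₁ N₂ N₁₂≤n))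

infix  4 _≈ᶜ_
infixl 6 _+ᶜ_
infixl 7 _*ᶜ_
infix  8 -ᶜ_

record ℂ : Set where
  constructor _+i_
  field
    re im : ℝ

open ℂ public

record _≈ᶜ_ (z w : ℂ) : Set where
  constructor _,_
  field
    re-≈ : re z ≈ʳ re w
    im-≈ : im z ≈ʳ im w

open _≈ᶜ_ public

_+ᶜ_ : ℂ → ℂ → ℂ
z +ᶜ w = (re z +ʳ re w) +i (im z +ʳ im w)

-ᶜ_ : ℂ → ℂ
-ᶜ z = (-ʳ re z) +i (-ʳ im z)

_*ᶜ_ : ℂ → ℂ → ℂ
z *ᶜ w = (re z *ʳ re w -ʳ im z *ʳ im w) +i (re z *ʳ im w +ʳ im z *ʳ re w)

0ᶜ 1ᶜ : ℂ
0ᶜ = 0ʳ +i 0ʳ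
1ᶜ = 1ʳ +i 0ʳ

fromℕ : ℕ → ℂ
fromℕ n = fromℚ (+ n / 1) +i 0ʳ

private
  pointwise⇒≈ᶜ : ∀ {z w} → (∀ n → seq (re z) n ≡ seq (re w) n) →
                 (∀ n → seq (im z) n ≡ seq (im w) n) → z ≈ᶜ w
  pointwise⇒≈ᶜ re-eq im-eq = pointwise⇒≈ʳ re-eq , pointwise⇒≈ʳ im-eq

  open +-*-Solver

  *ᶜ-assoc : ∀ x y z → (x *ᶜ y) *ᶜ z ≈ᶜ x *ᶜ (y *ᶜ z)
  *ᶜ-assoc (a +i b) (c +i d) (e +i f) = pointwise⇒≈ᶜ
    (λ n → solve 6 (λ a b c d e f →
        (a :* c :- b :* d) :* e :- (a :* d :+ b :* c) :* f :=
        a :* (c :* e :- d :* f) :- b :* (c :* f :+ d :* e)) refl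
      (seq a n) (seq b n) (seq c n) (seq d n) (seq e n) (seq f n))
    (λ n → solve 6 (λ a b c d e f →
        (a :* c :- b :* d) :* f :+ (a :* d :+ b :* c) :* e :=
        a :* (c :* f :+ d :* e) :+ b :* (c :* e :- d :* f)) refl
      (seq a n) (seq b n) (seq c n) (seq d n) (seq e n) (seq f n))

  *ᶜ-comm : ∀ x y → x *ᶜ y ≈ᶜ y *ᶜ x
  *ᶜ-comm (a +i b) (c +i d) = pointwise⇒≈ᶜ
    (λ n → solve 4 (λ a b c d → a :* c :- b :* d := c :* a :- d :* b) refl
      (seq a n) (seq b n) (seq c n) (seq d n))
    (λ n → solve 4 (λ a b c d → a :* d :+ b :* c := c :* b :+ d :* a) refl
      (seq a n) (seq b n) (seq c n) (seq d n))

  *ᶜ-identityˡ : ∀ x → 1ᶜ *ᶜ x ≈ᶜ x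
  *ᶜ-identityˡ (a +i b) = pointwise⇒≈ᶜ
    (λ n → solve 2 (λ a b → con 1ℚ :* a :- con 0ℚ :* b := a) refl (seq a n) (seq b n))
    (λ n → solve 2 (λ a b → con 1ℚ :* b :+ con 0ℚ :* a := b) refl (seq a n) (seq b n))

  *ᶜ-distribˡ-+ᶜ : ∀ x y z → x *ᶜ (y +ᶜ z) ≈ᶜ x *ᶜ y +ᶜ x *ᶜ z
  *ᶜ-distribˡ-+ᶜ (a +i b) (c +i d) (e +i f) = pointwise⇒≈ᶜ
    (λ n → solve 6 (λ a b c d e f →
        a :* (c :+ e) :- b :* (d :+ f) :=
        (a :* c :- b :* d) :+ (a :* e :- b :* f)) refl
      (seq a n) (seq b n) (seq c n) (seq d n) (seq e n) (seq f n))
    (λ n → solve 6 (λ a b c d e f →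
        a :* (d :+ f) :+ b :* (c :+ e) :=
        (a :* d :+ b :* c) :+ (a :* f :+ b :* e)) refl
      (seq a n) (seq b n) (seq c n) (seq d n) (seq e n) (seq f n))

  ≈ᶜ-trans : ∀ {x y z} → x ≈ᶜ y → y ≈ᶜ z → x ≈ᶜ z
  ≈ᶜ-trans (p , q) (r , s) = ≈ʳ-trans p r , ≈ʳ-trans q s

  +ᶜ-cong : ∀ {x x′ y y′} → x ≈ᶜ x′ → y ≈ᶜ y′ → x +ᶜ y ≈ᶜ x′ +ᶜ y′
  +ᶜ-cong (p , q) (r , s) = +ʳ-cong p r , +ʳ-cong q s

  *ᶜ-cong : ∀ {x x′ y y′} → x ≈ᶜ x′ → y ≈ᶜ y′ → x *ᶜ y ≈ᶜ x′ *ᶜ y′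
  *ᶜ-cong (p , q) (r , s) =
    +ʳ-cong (*ʳ-cong p r) (-ʳ-cong (*ʳ-cong q s)) , +ʳ-cong (*ʳ-cong p s) (*ʳ-cong q r)

ℂ-isCommutativeRing : IsCommutativeRing _≈ᶜ_ _+ᶜ_ _*ᶜ_ -ᶜ_ 0ᶜ 1ᶜ
ℂ-isCommutativeRing = record
  { isRing = record
    { +-isAbelianGroup = record
      { isGroup = record
        { isMonoid = record
          { isSemigroup = record
            { isMagma = record
              { isEquivalence = record
                { refl  = ≈ʳ-refl , ≈ʳ-refl
                ; sym   = λ (p , q) → ≈ʳ-sym p , ≈ʳ-sym q
                ; trans = ≈ᶜ-trans
                }
              ; ∙-cong = +ᶜ-cong
              }
            ; assoc = λ x y z → pointwise⇒≈ᶜ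
                (λ n → ℚ.+-assoc (seq (re x) n) (seq (re y) n) (seq (re z) n))
                (λ n → ℚ.+-assoc (seq (im x) n) (seq (im y) n) (seq (im z) n))
            }
          ; identity =
              (λ x → pointwise⇒≈ᶜ (λ n → ℚ.+-identityˡ _) (λ n → ℚ.+-identityˡ _)) ,
              (λ x → pointwise⇒≈ᶜ (λ n → ℚ.+-identityʳ _) (λ n → ℚ.+-identityʳ _))
          }
        ; inverse =
            (λ x → pointwise⇒≈ᶜ (λ n → ℚ.+-inverseˡ (seq (re x) n))
                                (λ n → ℚ.+-inverseˡ (seq (im x) n))) ,
            (λ x → pointwise⇒≈ᶜ (λ n → ℚ.+-inverseʳ (seq (re x) n))
                                (λ n → ℚ.+-inverseʳ (seq (im x) n)))
        ; ⁻¹-cong = λ (p , q) → -ʳ-cong p , -ʳ-cong q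
        }
      ; comm = λ x y → pointwise⇒≈ᶜ
          (λ n → ℚ.+-comm (seq (re x) n) (seq (re y) n))
          (λ n → ℚ.+-comm (seq (im x) n) (seq (im y) n))
      }
    ; *-cong     = *ᶜ-cong
    ; *-assoc    = *ᶜ-assoc
    ; *-identity = *ᶜ-identityˡ , λ x → ≈ᶜ-trans (*ᶜ-comm x 1ᶜ) (*ᶜ-identityˡ x)
    ; distrib    = *ᶜ-distribˡ-+ᶜ , λ x y z →
        ≈ᶜ-trans (*ᶜ-comm (y +ᶜ z) x)
          (≈ᶜ-trans (*ᶜ-distribˡ-+ᶜ x y z) (+ᶜ-cong (*ᶜ-comm x y) (*ᶜ-comm x z)))
    }
  ; *-comm = *ᶜ-comm
  }

ℂ-commutativeRing : CommutativeRing 0ℓ 0ℓ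
ℂ-commutativeRing = record { isCommutativeRing = ℂ-isCommutativeRing }

ℂ-+-rawMonoid : RawMonoid 0ℓ 0ℓ
ℂ-+-rawMonoid = record { _≈_ = _≈ᶜ_ ; _∙_ = _+ᶜ_ ; ε = 0ᶜ }

open RawMonoidDefs ℂ-+-rawMonoid public using () renaming (sum to sumᶜ)

{-# OPTIONS --safe #-}

-- The right-hand side, as a function of n, is a linear combination of solutions
-- of the recurrence and hence a solution itself.  Its value at n < k is F n,
-- because Bₙ(k,j) is then the Kronecker delta, and a solution of the recurrence
-- is determined by its first k values.

module Submission where

open import Defs
open import Data.Nat.Base using (ℕ; _≤_)
open import Data.Fin.Base using (toℕ)

open import Algebra.Bundles using (Monoid; CommutativeMonoid; CommutativeRing)
import Algebra.Properties.CommutativeMonoid.Sum as CommutativeMonoidSum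
import Algebra.Properties.Monoid.Sum as MonoidSum
import Algebra.Properties.Semiring.Sum as SemiringSum
open import Data.Fin.Base using (Fin; zero; suc; fromℕ<; punchIn)
open import Data.Fin.Properties using (toℕ<n; toℕ-fromℕ<; toℕ-injective; punchInᵢ≢i)
import Data.Integer.Base as ℤ
import Data.Integer.Properties as ℤ
open import Data.Nat.Base as ℕ using (suc; _<_; _∸_)
open import Data.Nat.Coprimality using (1-coprimeTo) renaming (sym to coprime-sym)
open import Data.Nat.Induction using (<-rec)
import Data.Nat.Properties as ℕ
import Data.Rational.Base as ℚ
import Data.Rational.Properties as ℚ
open import Data.Vec.Functional using (Vector)
open import Function.Base using (_∘_)
open import Relation.Binary.PropositionalEquality as ≡ using (_≡_; _≢_)
import Relation.Binary.Reasoning.Setoid as SetoidReasoning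
open import Relation.Nullary using (yes; no)

module _ {c ℓ} (M : Monoid c ℓ) where
  open Monoid M
  open MonoidSum M using (sum-cong-≋)

  -- Strong induction on `n`: below `k` the values agree by assumption, and from `k` on both
  -- recurrences sum, in the same order, values already known to agree.
  SumOfPrevious-unique : ∀ {k F G} →
    SumOfPrevious rawMonoid k F → SumOfPrevious rawMonoid k G →
    (∀ n → n < k → F n ≈ G n) → ∀ n → F n ≈ G n
  SumOfPrevious-unique {k} {F} {G} F-rec G-rec initial = <-rec _ step
    where
    step : ∀ n → (∀ {m} → m < n → F m ≈ G m) → F n ≈ G n
    step n ih with n ℕ.<? k
    ... | yes n<k = initial n n<k
    ... | no  n≮k = trans (F-rec n k≤n) (trans
      -- As `0 < suc (toℕ i) ≤ k ≤ n`, the truncated subtraction is exact and lands strictly below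
      -- `n`.
      (sum-cong-≋ λ i → ih (ℕ.∸-monoʳ-< ℕ.z<s (ℕ.≤-trans (toℕ<n i) k≤n)))
      (sym (G-rec n k≤n)))
      where
      k≤n : k ≤ n
      k≤n = ℕ.≮⇒≥ n≮k

module _ {c ℓ} (M : CommutativeMonoid c ℓ) where
  open CommutativeMonoid M
  open CommutativeMonoidSum M
    using (sum; sum-remove; sum-cong-≋; sum-replicate-zero)

  -- Collapses a sum against a Kronecker delta: the term at `i` is moved to the front, and
  -- `punchIn i` enumerates the remaining indices, all different from `i`.
  sum-single : ∀ {n} (t : Vector Carrier n) i →
               (∀ j → j ≢ i → t j ≈ ε) → sum t ≈ t i
  sum-single {suc n} t i others≈ε = begin
    sum t                              ≈⟨ sum-remove {i = i} t ⟩
    t i ∙ sum (λ j → t (punchIn i j))  ≈⟨ ∙-congˡ (sum-cong-≋ λ j →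
                                            others≈ε (punchIn i j) (punchInᵢ≢i i j)) ⟩
    t i ∙ sum {n} (λ _ → ε)            ≈⟨ ∙-congˡ (sum-replicate-zero n) ⟩
    t i ∙ ε                            ≈⟨ identityʳ (t i) ⟩
    t i                                ∎
    where open SetoidReasoning setoid

/1-homo-+ : ∀ m n → ℤ.+ (m ℕ.+ n) ℚ./ 1 ≡ (ℤ.+ m ℚ./ 1) ℚ.+ (ℤ.+ n ℚ./ 1)
/1-homo-+ m n = begin
  ℤ.+ (m ℕ.+ n) ℚ./ 1
    ≡⟨ ≡.cong (ℚ._/ 1) (≡.cong₂ ℤ._+_ (ℤ.*-identityʳ (ℤ.+ m)) (ℤ.*-identityʳ (ℤ.+ n))) ⟨
  (ℤ.+ m ℤ.* ℤ.1ℤ ℤ.+ ℤ.+ n ℤ.* ℤ.1ℤ) ℚ./ 1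
    -- `ℚ._+_` unfolds only on explicit fractions, while `/ 1` is stuck on a gcd for variable `m`;
    -- coprimality with 1 gives the reduced form `mkℚ`.
    ≡⟨ ≡.cong₂ ℚ._+_ (reduced m) (reduced n) ⟨
  (ℤ.+ m ℚ./ 1) ℚ.+ (ℤ.+ n ℚ./ 1)
    ∎
  where
  open ≡.≡-Reasoning
  reduced : ∀ m → ℤ.+ m ℚ./ 1 ≡ ℚ.mkℚ (ℤ.+ m) 0 (coprime-sym (1-coprimeTo m))
  reduced m = ℚ.normalize-coprime (coprime-sym (1-coprimeTo m))

open CommutativeRing ℂ-commutativeRing hiding (zero)
open SemiringSum semiring
  using (sum-cong-≋; ∑-comm; *-distribˡ-sum)
open MonoidSum ℕ.+-0-monoid using () renaming (sum to sumℕ)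
open SetoidReasoning setoid

fromℕ-homo-+ : ∀ m n → fromℕ (m ℕ.+ n) ≈ fromℕ m + fromℕ n
fromℕ-homo-+ m n = pointwise⇒≈ʳ (λ _ → /1-homo-+ m n) , pointwise⇒≈ʳ (λ _ → ≡.refl)

-- Carries the recurrence of `B`, which holds in `ℕ`, over to `ℂ`.
fromℕ-homo-sum : ∀ {n} (t : Vector ℕ n) → fromℕ (sumℕ t) ≈ sumᶜ (fromℕ ∘ t)
fromℕ-homo-sum {ℕ.zero} t = refl
fromℕ-homo-sum {suc n}  t = trans (fromℕ-homo-+ (t zero) (sumℕ (t ∘ suc)))
  (+-congˡ (fromℕ-homo-sum (t ∘ suc)))

-- Each `b j n` is expanded by its own recurrence; exchanging the two finite sums then regroups the
-- terms by shift.
combination-SumOfPrevious : ∀ k {m} (a : Vector ℂ m) (b : Fin m → ℕ → ℕ) →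
  (∀ j → SumOfPrevious ℕ.+-0-rawMonoid k (b j)) →
  SumOfPrevious ℂ-+-rawMonoid k (λ n → sumᶜ (λ j → a j * fromℕ (b j n)))
combination-SumOfPrevious k {m} a b b-rec n k≤n = begin
  sumᶜ (λ j → a j * fromℕ (b j n))
    ≈⟨ sum-cong-≋ (λ j → *-congˡ (reflexive (≡.cong fromℕ (b-rec j n k≤n)))) ⟩
  sumᶜ (λ j → a j * fromℕ (sumℕ {k} (λ i → b j (n ∸ suc (toℕ i)))))
    ≈⟨ sum-cong-≋ (λ j → trans (*-congˡ (fromℕ-homo-sum {k} _)) (*-distribˡ-sum {k} (a j) _)) ⟩
  sumᶜ (λ j → sumᶜ {k} (λ i → a j * fromℕ (b j (n ∸ suc (toℕ i)))))
    ≈⟨ ∑-comm {m} {k} (λ j i → a j * fromℕ (b j (n ∸ suc (toℕ i)))) ⟩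
  sumᶜ {k} (λ i → sumᶜ (λ j → a j * fromℕ (b j (n ∸ suc (toℕ i)))))
    ∎

combination-initial : ∀ k (F : ℕ → ℂ) (i : Fin k) →
  F (toℕ i) ≈ sumᶜ {k} (λ j → F (toℕ j) * fromℕ (B k j (toℕ i)))
combination-initial k F i = sym (begin
  sumᶜ {k} (λ j → F (toℕ j) * fromℕ (B k j (toℕ i)))
    ≈⟨ sum-single +-commutativeMonoid {k} _ i (λ j j≢i → trans
         (*-congˡ (reflexive (≡.cong fromℕ
           -- The inequality is wanted between naturals and in the opposite orientation.
           (B-initial-0 k j (toℕ i) (toℕ<n i) (j≢i ∘ ≡.sym ∘ toℕ-injective)))))
         (zeroʳ (F (toℕ j)))) ⟩
  F (toℕ i) * fromℕ (B k i (toℕ i))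
    ≈⟨ *-congˡ (reflexive (≡.cong fromℕ (B-initial-1 k i))) ⟩
  F (toℕ i) * 1#
    ≈⟨ *-identityʳ (F (toℕ i)) ⟩
  F (toℕ i)
    ∎)

theorem1 : (k : ℕ) → 2 ≤ k →
    (F : ℕ → ℂ) → SumOfPrevious ℂ-+-rawMonoid k F →
    (n : ℕ) → F n ≈ᶜ sumᶜ {k} (λ j → F (toℕ j) *ᶜ fromℕ (B k j n))
theorem1 k _ F F-rec = SumOfPrevious-unique +-monoid F-rec
  (combination-SumOfPrevious k (F ∘ toℕ) (B k) (B-recurrence k))
  -- The initial values are indexed by `Fin k`, so `n` is first written as `toℕ (fromℕ< n<k)`.
  λ n n<k → ≡.subst (λ m → F m ≈ sumᶜ {k} (λ j → F (toℕ j) * fromℕ (B k j m)))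
    (toℕ-fromℕ< n<k) (combination-initial k F (fromℕ< n<k))
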